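{- For every integer $k\ge 2$, the tree $T_k$ satisfies $\mathrm{ern}(T_k)=3$.
   Context: For $k\ge1$, $T_k$ denotes the tree on $3k+1$ vertices consisting of a central vertex with $k$ neighbours, each of which is adjacent, besides the central vertex, to exactly two vertices of degree 1. All graphs are finite, simple and undirected. An edge-card of a graph $G$ is an edge-deleted subgraph $G-e$ (all vertices are kept), considered up to isomorphism. For distinct edges $e_1,\dots,e_k$ of $G$, the edge-cards $G-e_1,\dots,G-e_k$ are said to reconstruct $G$ if every graph $H$ having distinct edges $f_1,\dots,f_k$ with $H-f_i\simeq G-e_i$ for all $i$ is isomorphic to $G$ ($H$ ranges over all graphs, not only trees). The edge-reconstruction number $\mathrm{ern}(G)$ is the least $k$ for which some $k$ edge-cards of $G$ reconstruct $G$. -}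

module Defs where

open import Data.Bool.Base using (Bool; true; false; T; _∧_; _∨_; not)
open import Data.Bool.Properties using (∧-comm; ∨-comm; T-irrelevant)
open import Data.Fin.Base using (Fin; zero; suc; _<_; remQuot)
open import Data.Fin.Properties using (_≟_; <-irrelevant)
open import Data.Nat.Base as ℕ using (ℕ)
open import Data.Product.Base using (Σ-syntax; _×_; _,_)
open import Function.Bundles using (_↔_; _↣_; Inverse; Injection)
open import Relation.Binary.PropositionalEquality
open import Relation.Nullary.Decidable using (⌊_⌋; yes; no)
open import Relation.Nullary.Negation using (contradiction)

record Graph : Set where
  field
    order  : ℕ
    adj    : Fin order → Fin order → Bool
    symm   : ∀ u v → adj u v ≡ adj v u
    irrefl : ∀ v → adj v v ≡ false

open Graph public

-- An unordered pair {src , tgt} is represented by its increasing listing, so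
-- each edge has exactly one representative; see Edge-≡.
record Edge (G : Graph) : Set where
  constructor edge
  field
    src tgt  : Fin (order G)
    ordered  : src < tgt
    adjacent : T (adj G src tgt)

open Edge public

Edge-≡ : ∀ {G} {e f : Edge G} → src e ≡ src f → tgt e ≡ tgt f → e ≡ f
Edge-≡ {e = edge a b p x} {edge .a .b q y} refl refl =
  cong₂ (edge a b) (<-irrelevant p q) (T-irrelevant x y)

-- {u , v} = {a , b} as unordered pairs.
samePair : ∀ {n} (a b u v : Fin n) → Bool
samePair a b u v = (⌊ u ≟ a ⌋ ∧ ⌊ v ≟ b ⌋) ∨ (⌊ u ≟ b ⌋ ∧ ⌊ v ≟ a ⌋)

samePair-sym : ∀ {n} (a b u v : Fin n) → samePair a b u v ≡ samePair a b v u
samePair-sym a b u v = trans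
  (∨-comm (⌊ u ≟ a ⌋ ∧ ⌊ v ≟ b ⌋) _)
  (cong₂ _∨_ (∧-comm ⌊ u ≟ b ⌋ _) (∧-comm ⌊ u ≟ a ⌋ _))

infixl 6 _-ₑ_

_-ₑ_ : (G : Graph) → Edge G → Graph
G -ₑ e = record
  { order  = order G
  ; adj    = λ u v → adj G u v ∧ not (samePair (src e) (tgt e) u v)
  ; symm   = λ u v → cong₂ (λ x y → x ∧ not y)
                       (symm G u v) (samePair-sym (src e) (tgt e) u v)
  ; irrefl = λ v → cong (_∧ not (samePair (src e) (tgt e) v v)) (irrefl G v)
  }

infix 4 _≃_

_≃_ : Graph → Graph → Set
G ≃ H = Σ[ φ ∈ Fin (order G) ↔ Fin (order H) ]
          (∀ u v → adj G u v ≡ adj H (Inverse.to φ u) (Inverse.to φ v))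

DistinctEdges : ℕ → Graph → Set
DistinctEdges k G = Fin k ↣ Edge G

Reconstruct : (G : Graph) {k : ℕ} → DistinctEdges k G → Set
Reconstruct G {k} e =
  (H : Graph) (f : DistinctEdges k H) →
  (∀ i → (H -ₑ Injection.to f i) ≃ (G -ₑ Injection.to e i)) →
  H ≃ G

ReconstructibleFrom : Graph → ℕ → Set
ReconstructibleFrom G k = Σ[ e ∈ DistinctEdges k G ] Reconstruct G e

-- ern(G) = r.  This is a relation because some graphs are not reconstructed
-- by any set of their edge-cards, so that ern is only partially defined.
IsErn : Graph → ℕ → Set
IsErn G r =
  ReconstructibleFrom G r × (∀ k → ReconstructibleFrom G k → r ℕ.≤ k)

data TreeVertex (k : ℕ) : Set where
  centre : TreeVertex k
  branch : Fin k → TreeVertex k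
  leaf   : Fin k → Fin 2 → TreeVertex k

treeAdj : ∀ {k} → TreeVertex k → TreeVertex k → Bool
treeAdj centre     (branch _) = true
treeAdj (branch _) centre     = true
treeAdj (branch i) (leaf j _) = ⌊ i ≟ j ⌋
treeAdj (leaf i _) (branch j) = ⌊ i ≟ j ⌋
treeAdj _          _          = false

≟-sym : ∀ {n} (i j : Fin n) → ⌊ i ≟ j ⌋ ≡ ⌊ j ≟ i ⌋
≟-sym i j with i ≟ j | j ≟ i
... | yes _ | yes _ = refl
... | no _  | no _  = refl
... | yes p | no ¬q = contradiction (sym p) ¬q
... | no ¬p | yes q = contradiction (sym q) ¬p

treeAdj-sym : ∀ {k} (x y : TreeVertex k) → treeAdj x y ≡ treeAdj y x
treeAdj-sym centre     centre     = refl
treeAdj-sym centre     (branch _) = refl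
treeAdj-sym centre     (leaf _ _) = refl
treeAdj-sym (branch _) centre     = refl
treeAdj-sym (branch _) (branch _) = refl
treeAdj-sym (branch i) (leaf j _) = ≟-sym i j
treeAdj-sym (leaf _ _) centre     = refl
treeAdj-sym (leaf i _) (branch j) = ≟-sym i j
treeAdj-sym (leaf _ _) (leaf _ _) = refl

treeAdj-irrefl : ∀ {k} (x : TreeVertex k) → treeAdj x x ≡ false
treeAdj-irrefl centre     = refl
treeAdj-irrefl (branch _) = refl
treeAdj-irrefl (leaf _ _) = refl

-- Vertex 0 is the centre; the other 3k vertices are numbered by pairs
-- (role , j) with role 0 for the j-th neighbour of the centre and roles 1, 2
-- for the two leaves attached to it.  remQuot {3} k is the bijection
-- Fin (3 * k) ≅ Fin 3 × Fin k.
treeVertex : ∀ {k} → Fin (1 ℕ.+ 3 ℕ.* k) → TreeVertex k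
treeVertex zero = centre
treeVertex {k} (suc i) with remQuot {3} k i
... | zero  , j = branch j
... | suc l , j = leaf j l

Tree : ℕ → Graph
Tree k = record
  { order  = 1 ℕ.+ 3 ℕ.* k
  ; adj    = λ u v → treeAdj {k} (treeVertex u) (treeVertex v)
  ; symm   = λ u v → treeAdj-sym {k} (treeVertex u) (treeVertex v)
  ; irrefl = λ v → treeAdj-irrefl {k} (treeVertex v)
  }

{-# OPTIONS --safe #-}
module Submission where

-- Call c the centre, b₀, b₁, … its neighbours and l₀, l₁ the leaves at b₀.
--
-- Three cards suffice: take the cards of c b₀, c b₁ and b₀ l₀.  If H has these
-- cards, then H has no isolated vertex, so by the third card H is the tree with
-- l₀ reattached to some vertex w.  If w ≠ b₀, then H contains a path u v x y
-- with u a leaf and v of degree two (l₀ l₁ b₀ c if w = l₁, and l₁ b₀ c b₁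
-- otherwise).  The first two cards contain no such path, no isolated vertex and
-- no isolated edge, so the two edges of H giving them both have to be x y.
--
-- Two cards do not suffice: up to isomorphism there are only the cards of c b₀
-- and of b₀ l₀, and each of the three pairs of these is shared by a graph that
-- arises from the tree by moving one edge: c b₀ to l₀ l₁, b₀ l₀ to c l₁, or
-- c b₀ to c l₁.  The first two contain a triangle, the third a path as above.

open import Defs
open import Data.Bool.Base using (Bool; true; false; T; _∧_; _∨_; not)
open import Data.Bool.Properties
  using (T-≡; T-∧; T-∨; T-not-≡; T?; ⇔→≡; ∧-identityʳ; ∨-identityʳ)
import Data.Bool.Properties as Bool
open import Data.Empty using (⊥; ⊥-elim)
open import Data.Fin.Base using (Fin; zero; suc; combine; remQuot)
open import Data.Fin.Patterns using (0F; 1F; 2F; 3F)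
open import Data.Fin.Permutation using (Permutation′; transpose)
open import Data.Fin.Properties
  using (all?; <-cmp; <-asym; remQuot-combine; combine-remQuot)
  renaming (_≟_ to _≟F_)
open import Data.Nat.Base using (ℕ; zero; suc; _≤_; z≤n; s≤s; _+_; _*_)
open import Data.Product.Base using (Σ-syntax; ∃-syntax; _×_; _,_; proj₁; proj₂; uncurry)
open import Data.Sum.Base using (_⊎_; inj₁; inj₂; [_,_]′; map)
open import Function.Base using (id; _∘_)
open import Function.Bundles
  using (_↔_; _↣_; Inverse; Injection; Equivalence; mk⇔; mk↔ₛ′; mk↣)
open import Function.Definitions using (Injective)
open import Function.Properties.Inverse using (↔-refl; ↔-sym; ↔-trans; ↔⇒↣)
open import Relation.Binary.Definitions using (DecidableEquality; tri<; tri≈; tri>)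
open import Relation.Binary.PropositionalEquality
open import Relation.Nullary.Decidable
  using (Dec; yes; no; ⌊_⌋; map′; _×-dec_; toWitness; fromWitness; from-yes; dec-true)
open import Relation.Nullary.Negation using (¬_; contradiction)

open Equivalence using () renaming (to to ⇒; from to ⇐)
open Inverse using (strictlyInverseˡ; strictlyInverseʳ) renaming (to to _⟶_; from to _⟵_)

private
  variable
    A B C : Set
    k n : ℕ

-- Truth of Booleans and injectivity of bijections

T-injective : ∀ {x y} → (T x → T y) → (T y → T x) → x ≡ y
T-injective {x} {y} f g = ⇔→≡ {x} {y} {true}
  (mk⇔ (⇒ T-≡ ∘ f ∘ ⇐ T-≡) (⇒ T-≡ ∘ g ∘ ⇐ T-≡))

¬T⇒T-not : ∀ {x} → ¬ T x → T (not x)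
¬T⇒T-not {true}  ¬t = ⊥-elim (¬t _)
¬T⇒T-not {false} ¬t = _

T-not⇒¬T : ∀ {x} → T (not x) → ¬ T x
T-not⇒¬T {true} ()

↔-injective : (φ : A ↔ B) → Injective _≡_ _≡_ (φ ⟶_)
↔-injective φ = Injection.injective (↔⇒↣ φ)

-- Unordered pairs

IsPair : A → A → A → A → Set
IsPair a b u v = (u ≡ a × v ≡ b) ⊎ (u ≡ b × v ≡ a)

IsPair-swap : ∀ {a b u v : A} → IsPair a b u v → IsPair b a u v
IsPair-swap (inj₁ p) = inj₂ p
IsPair-swap (inj₂ p) = inj₁ p

IsPair-swapʳ : ∀ {a b u v : A} → IsPair a b u v → IsPair a b v u
IsPair-swapʳ (inj₁ (p , q)) = inj₂ (q , p)
IsPair-swapʳ (inj₂ (p , q)) = inj₁ (q , p)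

IsPair-sym : ∀ {a b u v : A} → IsPair a b u v → IsPair u v a b
IsPair-sym (inj₁ (refl , refl)) = inj₁ (refl , refl)
IsPair-sym (inj₂ (refl , refl)) = inj₂ (refl , refl)

IsPair-trans : ∀ {a b u v x y : A} → IsPair a b u v → IsPair u v x y → IsPair a b x y
IsPair-trans (inj₁ (refl , refl)) q = q
IsPair-trans (inj₂ (refl , refl)) q = IsPair-swap q

IsPair-map : (f : A → B) → ∀ {a b u v : A} → IsPair a b u v → IsPair (f a) (f b) (f u) (f v)
IsPair-map f (inj₁ (refl , refl)) = inj₁ (refl , refl)
IsPair-map f (inj₂ (refl , refl)) = inj₂ (refl , refl)

IsPair-unmap : {f : A → B} → Injective _≡_ _≡_ f →
               ∀ {a b u v : A} → IsPair (f a) (f b) (f u) (f v) → IsPair a b u v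
IsPair-unmap inj (inj₁ (p , q)) = inj₁ (inj p , inj q)
IsPair-unmap inj (inj₂ (p , q)) = inj₂ (inj p , inj q)

module _ (_≟_ : DecidableEquality A) where

  -- With the decision procedure of `Fin` this is definitionally `samePair`, so that the facts below
  -- apply to `_-ₑ_` directly. The general form also serves `TreeVertex`.
  pairᵇ : A → A → A → A → Bool
  pairᵇ a b u v = (⌊ u ≟ a ⌋ ∧ ⌊ v ≟ b ⌋) ∨ (⌊ u ≟ b ⌋ ∧ ⌊ v ≟ a ⌋)

  pairᵇ⇒IsPair : ∀ {a b} u v → T (pairᵇ a b u v) → IsPair a b u v
  pairᵇ⇒IsPair {a} {b} u v t with u ≟ a | v ≟ b | u ≟ b | v ≟ a
  ... | yes p | yes q | _     | _     = inj₁ (p , q)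
  ... | yes _ | no  _ | yes p | yes q = inj₂ (p , q)
  ... | no  _ | _     | yes p | yes q = inj₂ (p , q)
  ... | yes _ | no  _ | no  _ | _     = ⊥-elim t
  ... | yes _ | no  _ | yes _ | no  _ = ⊥-elim t
  ... | no  _ | _     | no  _ | _     = ⊥-elim t
  ... | no  _ | _     | yes _ | no  _ = ⊥-elim t

  IsPair⇒pairᵇ : ∀ {a b} u v → IsPair a b u v → T (pairᵇ a b u v)
  IsPair⇒pairᵇ {a} {b} u v (inj₁ (p , q)) = ⇐ T-∨ (inj₁ (⇐ (T-∧ {⌊ u ≟ a ⌋} {⌊ v ≟ b ⌋})
    (fromWitness {a? = u ≟ a} p , fromWitness {a? = v ≟ b} q)))
  IsPair⇒pairᵇ {a} {b} u v (inj₂ (p , q)) = ⇐ (T-∨ {⌊ u ≟ a ⌋ ∧ ⌊ v ≟ b ⌋})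
    (inj₂ (⇐ (T-∧ {⌊ u ≟ b ⌋} {⌊ v ≟ a ⌋})
      (fromWitness {a? = u ≟ b} p , fromWitness {a? = v ≟ a} q)))

  isPair? : ∀ a b u v → Dec (IsPair a b u v)
  isPair? a b u v = map′ (pairᵇ⇒IsPair u v) (IsPair⇒pairᵇ u v) (T? (pairᵇ a b u v))

  pairᵇ-false : ∀ {a b u v} → ¬ IsPair a b u v → pairᵇ a b u v ≡ false
  pairᵇ-false {u = u} {v} ¬p = ⇒ T-not-≡ (¬T⇒T-not (¬p ∘ pairᵇ⇒IsPair u v))

pairᵇ-cong : (_≟_ : DecidableEquality A) (_≟′_ : DecidableEquality B) →
             ∀ {a b u v} {a′ b′ u′ v′} →
             (IsPair a b u v → IsPair a′ b′ u′ v′) →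
             (IsPair a′ b′ u′ v′ → IsPair a b u v) →
             pairᵇ _≟_ a b u v ≡ pairᵇ _≟′_ a′ b′ u′ v′
pairᵇ-cong _≟_ _≟′_ {u = u} {v} {u′ = u′} {v′} f g = T-injective
  (IsPair⇒pairᵇ _≟′_ u′ v′ ∘ f ∘ pairᵇ⇒IsPair _≟_ u v)
  (IsPair⇒pairᵇ _≟_ u v ∘ g ∘ pairᵇ⇒IsPair _≟′_ u′ v′)

-- Graphs and their edge-cards

Adj : (G : Graph) → Fin (order G) → Fin (order G) → Set
Adj G u v = T (adj G u v)

Adj-sym : ∀ G {u v} → Adj G u v → Adj G v u
Adj-sym G {u} {v} = subst T (symm G u v)

Adj⇒≢ : ∀ G {u v} → Adj G u v → u ≢ v
Adj⇒≢ G {u} uu refl = subst T (irrefl G u) uu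

Joins : (G : Graph) → Edge G → Fin (order G) → Fin (order G) → Set
Joins G e = IsPair (src e) (tgt e)

-- The increasing listing of the ends rules out the two crossed cases.
joins-unique : ∀ {G} {e f : Edge G} {u v} → Joins G e u v → Joins G f u v → e ≡ f
joins-unique {G} (inj₁ (refl , refl)) (inj₁ (p , q)) = Edge-≡ {G} p q
joins-unique {G} (inj₂ (refl , refl)) (inj₂ (p , q)) = Edge-≡ {G} q p
joins-unique {e = e} {f} (inj₁ (refl , refl)) (inj₂ (refl , refl)) =
  ⊥-elim (<-asym (ordered e) (ordered f))
joins-unique {e = e} {f} (inj₂ (refl , refl)) (inj₁ (refl , refl)) =
  ⊥-elim (<-asym (ordered e) (ordered f))

edgeBetween : (G : Graph) (u v : Fin (order G)) → Adj G u v →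
              Σ[ e ∈ Edge G ] Joins G e u v
edgeBetween G u v uv with <-cmp u v
... | tri< u<v _ _ = edge u v u<v uv , inj₁ (refl , refl)
... | tri≈ _ u≡v _ = ⊥-elim (Adj⇒≢ G uv u≡v)
... | tri> _ _ v<u = edge v u v<u (Adj-sym G uv) , inj₂ (refl , refl)

card⇒Adj : ∀ G e {u v} → Adj (G -ₑ e) u v → Adj G u v
card⇒Adj G e = proj₁ ∘ ⇒ T-∧

card⇒¬Joins : ∀ G e {u v} → Adj (G -ₑ e) u v → ¬ Joins G e u v
card⇒¬Joins G e {u} {v} uv =
  T-not⇒¬T (proj₂ (⇒ (T-∧ {adj G u v}) uv)) ∘ IsPair⇒pairᵇ _≟F_ u v

Adj⇒card : ∀ G e {u v} → Adj G u v → ¬ Joins G e u v → Adj (G -ₑ e) u v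
Adj⇒card G e {u} {v} uv ¬p = ⇐ T-∧ (uv , ¬T⇒T-not (¬p ∘ pairᵇ⇒IsPair _≟F_ u v))

joins? : ∀ G e u v → Dec (Joins G e u v)
joins? G e = isPair? _≟F_ (src e) (tgt e)

≃-sym : ∀ {G H} → G ≃ H → H ≃ G
≃-sym {G} {H} (φ , h) = ↔-sym φ , λ u v → sym (trans
  (h (φ ⟵ u) (φ ⟵ v)) (cong₂ (adj H) (strictlyInverseˡ φ u) (strictlyInverseˡ φ v)))

≃-trans : ∀ {G H K} → G ≃ H → H ≃ K → G ≃ K
≃-trans (φ , h) (ψ , h′) = ↔-trans φ ψ , λ u v → trans (h u v) (h′ (φ ⟶ u) (φ ⟶ v))

-- Isomorphism of relations

-- Relations on arbitrary types, so that a graph on `Fin` can be compared with an inductively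
-- defined adjacency on named vertices.
record _≅_ {A B : Set} (R : A → A → Set) (S : B → B → Set) : Set where
  field
    bij : A ↔ B
    fwd : ∀ {u v} → R u v → S (bij ⟶ u) (bij ⟶ v)
    bwd : ∀ {u v} → S (bij ⟶ u) (bij ⟶ v) → R u v

open _≅_

≅-sym : ∀ {R : A → A → Set} {S : B → B → Set} → R ≅ S → S ≅ R
≅-sym {R = R} {S} i = record
  { bij = ↔-sym (bij i)
  ; fwd = λ {u} {v} s → bwd i (subst₂ S (sym (strictlyInverseˡ (bij i) u))
                                        (sym (strictlyInverseˡ (bij i) v)) s)
  ; bwd = λ {u} {v} r → subst₂ S (strictlyInverseˡ (bij i) u)
                                 (strictlyInverseˡ (bij i) v) (fwd i r)
  }

≅-trans : ∀ {R : A → A → Set} {S : B → B → Set} {U : C → C → Set} →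
          R ≅ S → S ≅ U → R ≅ U
≅-trans i j = record
  { bij = ↔-trans (bij i) (bij j)
  ; fwd = fwd j ∘ fwd i
  ; bwd = bwd i ∘ bwd j
  }

≃⇒≅ : ∀ {G H} → G ≃ H → Adj G ≅ Adj H
≃⇒≅ (φ , h) = record
  { bij = φ
  ; fwd = λ {u} {v} → subst T (h u v)
  ; bwd = λ {u} {v} → subst T (sym (h u v))
  }

≅⇒≃ : ∀ {G H} → Adj G ≅ Adj H → G ≃ H
≅⇒≃ i = bij i , λ _ _ → T-injective (fwd i) (bwd i)

-- Tails, and relations that exclude them

-- A path `u` `v` `x` `y` in which `u` has degree one and `v` degree two. The ends of its last edge
-- are parameters because that edge is the one to be identified among the deleted edges.
record Tail {A : Set} (R : A → A → Set) (x y : A) : Set where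
  field
    {u v}  : A
    uv     : R u v
    vx     : R v x
    xy     : R x y
    u≢x    : u ≢ x
    v≢y    : v ≢ y
    only-u : ∀ {z} → R u z → z ≡ v
    only-v : ∀ {z} → R v z → z ≡ u ⊎ z ≡ x

-- What is retained of a card of a centre edge: each field excludes one kind of edge, other than the
-- last edge of a tail, as the deleted one.
record Bushy {A : Set} (R : A → A → Set) : Set where
  field
    noIsolated : ∀ u → ∃[ v ] R u v
    noK₂       : ∀ {u v} → R u v → (∃[ x ] x ≢ v × R u x) ⊎ (∃[ x ] x ≢ u × R v x)
    noTail     : ∀ {x y} → ¬ Tail R x y

open Tail
open Bushy

module _ {R : A → A → Set} {S : B → B → Set} (i : R ≅ S) where

  private
    f = bij i ⟶_
    g = bij i ⟵_

    pull : ∀ {u w} → S (f u) w → R u (g w)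
    pull {u} {w} s = bwd i (subst (S (f u)) (sym (strictlyInverseˡ (bij i) w)) s)

    f-g : ∀ {w u} → g w ≡ u → w ≡ f u
    f-g {w} eq = trans (sym (strictlyInverseˡ (bij i) w)) (cong f eq)

  -- The two degree conditions concern all neighbours in `S`, which are pulled back to `R` through
  -- the inverse bijection.
  Tail-map : ∀ {x y} → Tail R x y → Tail S (f x) (f y)
  Tail-map t = record
    { uv     = fwd i (uv t)
    ; vx     = fwd i (vx t)
    ; xy     = fwd i (xy t)
    ; u≢x    = u≢x t ∘ ↔-injective (bij i)
    ; v≢y    = v≢y t ∘ ↔-injective (bij i)
    ; only-u = λ s → f-g (only-u t (pull s))
    ; only-v = λ s → [ inj₁ ∘ f-g , inj₂ ∘ f-g ]′ (only-v t (pull s))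
    }

  -- The direction fits the use: the target of the isomorphism is a card of the tree, where
  -- bushiness is checked by hand.
  Bushy-pull : Bushy S → Bushy R
  Bushy-pull b = record
    { noIsolated = λ u → let w , s = noIsolated b (f u) in g w , pull s
    ; noK₂       = λ r → [ (λ (w , w≢ , s) → inj₁ (g w , w≢ ∘ f-g , pull s))
                         , (λ (w , w≢ , s) → inj₂ (g w , w≢ ∘ f-g , pull s))
                         ]′ (noK₂ b (fwd i r))
    ; noTail     = noTail b ∘ Tail-map
    }

-- Deleting uv isolates u, deleting vx isolates the edge uv, and deleting any
-- edge other than xy preserves the tail.
tail-edge : ∀ H (f : Edge H) {x y} → Tail (Adj H) x y → Bushy (Adj (H -ₑ f)) → Joins H f x y
tail-edge H f {x} {y} t b with joins? H f (u t) (v t)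
... | yes j =
  let z , uz = noIsolated b (u t)
  in ⊥-elim (card⇒¬Joins H f uz
       (subst (Joins H f (u t)) (sym (only-u t (card⇒Adj H f uz))) j))
... | no ¬uv with joins? H f (v t) x
...   | yes j with noK₂ b (Adj⇒card H f (uv t) ¬uv)
...     | inj₁ (z , z≢v , uz) = ⊥-elim (z≢v (only-u t (card⇒Adj H f uz)))
...     | inj₂ (z , z≢u , vz) with only-v t (card⇒Adj H f vz)
...       | inj₁ z≡u  = ⊥-elim (z≢u z≡u)
...       | inj₂ refl = ⊥-elim (card⇒¬Joins H f vz j)
tail-edge H f {x} {y} t b | no ¬uv | no ¬vx with joins? H f x y
... | yes j   = j
... | no  ¬xy = ⊥-elim (noTail b record
  { uv     = Adj⇒card H f (uv t) ¬uv
  ; vx     = Adj⇒card H f (vx t) ¬vx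
  ; xy     = Adj⇒card H f (xy t) ¬xy
  ; u≢x    = u≢x t
  ; v≢y    = v≢y t
  ; only-u = only-u t ∘ card⇒Adj H f
  ; only-v = only-v t ∘ card⇒Adj H f
  })

-- The tree

index : TreeVertex k → Fin (1 + 3 * k)
index centre         = zero
index (branch i)     = suc (combine {3} zero i)
index (leaf i t)     = suc (combine {3} (suc t) i)

treeVertex-index : (x : TreeVertex k) → treeVertex (index x) ≡ x
treeVertex-index centre = refl
treeVertex-index {k} (branch i) rewrite remQuot-combine {3} {k} zero i = refl
treeVertex-index {k} (leaf i t) rewrite remQuot-combine {3} {k} (suc t) i = refl

index-treeVertex : (u : Fin (1 + 3 * k)) → index (treeVertex {k} u) ≡ u
index-treeVertex zero = refl
index-treeVertex {k} (suc i) with remQuot {3} k i in eq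
... | zero  , j = cong suc (trans (cong (uncurry combine) (sym eq)) (combine-remQuot {3} k i))
... | suc l , j = cong suc (trans (cong (uncurry combine) (sym eq)) (combine-remQuot {3} k i))

vertices : Fin (1 + 3 * k) ↔ TreeVertex k
vertices {k} = mk↔ₛ′ treeVertex index treeVertex-index (index-treeVertex {k})

branch-injective : ∀ {i j : Fin k} → branch i ≡ branch j → i ≡ j
branch-injective refl = refl

leaf-injective : ∀ {i j : Fin k} {s t} → leaf i s ≡ leaf j t → i ≡ j × s ≡ t
leaf-injective refl = refl , refl

infix 4 _≟V_

_≟V_ : DecidableEquality (TreeVertex k)
centre   ≟V centre   = yes refl
centre   ≟V branch _ = no λ ()
centre   ≟V leaf _ _ = no λ ()
branch _ ≟V centre   = no λ ()
branch i ≟V branch j = map′ (cong branch) branch-injective (i ≟F j)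
branch _ ≟V leaf _ _ = no λ ()
leaf _ _ ≟V centre   = no λ ()
leaf _ _ ≟V branch _ = no λ ()
leaf i s ≟V leaf j t = map′ (uncurry (cong₂ leaf)) leaf-injective (i ≟F j ×-dec s ≟F t)

infix 4 _~_

-- Adjacency in the tree as an inductive family, so that impossible adjacencies vanish under pattern
-- matching.
data _~_ {k} : TreeVertex k → TreeVertex k → Set where
  c~b : ∀ {i} → centre ~ branch i
  b~c : ∀ {i} → branch i ~ centre
  b~l : ∀ {i t} → branch i ~ leaf i t
  l~b : ∀ {i t} → leaf i t ~ branch i

treeAdj⇒~ : (x y : TreeVertex k) → T (treeAdj x y) → x ~ y
treeAdj⇒~ centre     (branch _) _ = c~b
treeAdj⇒~ (branch _) centre     _ = b~c
treeAdj⇒~ (branch i) (leaf j _) t with refl ← toWitness {a? = i ≟F j} t = b~l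
treeAdj⇒~ (leaf i _) (branch j) t with refl ← toWitness {a? = i ≟F j} t = l~b

~⇒treeAdj : {x y : TreeVertex k} → x ~ y → T (treeAdj x y)
~⇒treeAdj c~b = _
~⇒treeAdj b~c = _
~⇒treeAdj b~l = fromWitness refl
~⇒treeAdj l~b = fromWitness refl

tree≅~ : Adj (Tree k) ≅ _~_ {k}
tree≅~ = record { bij = vertices ; fwd = treeAdj⇒~ _ _ ; bwd = ~⇒treeAdj }

Delete : (A → A → Set) → A → A → A → A → Set
Delete R a b x y = R x y × ¬ IsPair a b x y

-- Replaces Boolean edge deletion on numbered vertices by deletion from a relation such as `_~_`,
-- with the ends of the edge named in either order.
card≅Delete : ∀ G {S : B → B → Set} (i : Adj G ≅ S) (e : Edge G) {x y} →
              IsPair x y (bij i ⟶ src e) (bij i ⟶ tgt e) → Adj (G -ₑ e) ≅ Delete S x y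
card≅Delete G i e j = record
  { bij = bij i
  ; fwd = λ uv → fwd i (card⇒Adj G e uv) ,
                 card⇒¬Joins G e uv ∘ IsPair-unmap (↔-injective (bij i))
                                    ∘ IsPair-trans (IsPair-sym j)
  ; bwd = λ (s , ¬p) → Adj⇒card G e (bwd i s) (¬p ∘ IsPair-trans j ∘ IsPair-map (bij i ⟶_))
  }

other : Fin 2 → Fin 2
other 0F = 1F
other 1F = 0F

other-≢ : ∀ t → other t ≢ t
other-≢ 0F ()
other-≢ 1F ()

module _ {R : TreeVertex k → TreeVertex k → Set}
         (R⇒~ : ∀ {x y} → R x y → x ~ y)
         (b-l : ∀ {i t} → R (branch i) (leaf i t)) where

  -- A branch vertex has two leaves, so `u` is the centre or a leaf and `v` is a branch vertex. If
  -- `u` is the centre, both leaves of `v` would have to be `x`. If `u` is a leaf, then either `x`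
  -- is a leaf, which leads only back to `v`, or `x` is the centre and the other leaf is a third
  -- neighbour of `v`.
  ¬Tail : ∀ {x y} → ¬ Tail R x y
  ¬Tail t with u t | v t | R⇒~ (uv t) | R⇒~ (vx t) | R⇒~ (xy t)
             | u≢x t | v≢y t | only-u t | only-v t
  ... | _ | _ | c~b | _   | _   | _ | _   | _ | only =
    case₂ (only (b-l {t = 0F})) (only (b-l {t = 1F}))
    where
    case₂ : ∀ {i x} → leaf i 0F ≡ centre ⊎ leaf i 0F ≡ x →
            leaf i 1F ≡ centre ⊎ leaf i 1F ≡ x → ⊥
    case₂ (inj₂ refl) (inj₂ ())
  ... | _ | _ | b~c | _   | _   | _ | _   | only | _ with () ← only (b-l {t = 0F})
  ... | _ | _ | b~l | _   | _   | _ | _   | only | _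
    with refl ← only (b-l {t = 0F}) with () ← only (b-l {t = 1F})
  ... | _ | _ | l~b | b~l | l~b | _ | v≢y | _    | _ = v≢y refl
  ... | _ | _ | l~b {t = s} | b~c | _ | _ | _ | _ | only with only (b-l {t = other s})
  ...   | inj₁ eq = other-≢ s (proj₂ (leaf-injective eq))

-- Upper bound

-- The centre keeps the neighbour `branch i`, which is where a second branch is required. Each
-- remaining edge meets a branch vertex, and that vertex has a leaf off the edge.
bushyCard : ∀ {i j : Fin k} → i ≢ j → Bushy (Delete _~_ centre (branch j))
bushyCard {i = i} {j} i≢j = record
  { noIsolated = λ where
      centre     → branch i , c~b , λ where
                     (inj₁ (_ , eq)) → i≢j (branch-injective eq)
                     (inj₂ (() , _))
      (branch h) → leaf h 0F , b-l
      (leaf h t) → branch h , l-b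
  ; noK₂ = λ where
      (c~b , _)         → inj₂ (_ , (λ ()) , b-l {t = 0F})
      (b~c , _)         → inj₁ (_ , (λ ()) , b-l {t = 0F})
      (b~l {t = t} , _) → inj₁ (_ , other-≢ t ∘ proj₂ ∘ leaf-injective , b-l {t = other t})
      (l~b {t = t} , _) → inj₂ (_ , other-≢ t ∘ proj₂ ∘ leaf-injective , b-l {t = other t})
  ; noTail = ¬Tail proj₁ b-l
  }
  where
  b-l : ∀ {h t} → Delete _~_ centre (branch j) (branch h) (leaf h t)
  b-l = b~l , λ { (inj₁ (() , _)) ; (inj₂ (_ , ())) }
  l-b : ∀ {h t} → Delete _~_ centre (branch j) (leaf h t) (branch h)
  l-b = l~b , λ { (inj₁ (() , _)) ; (inj₂ (() , _)) }

module _ {m : ℕ} where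

  private
    k₂ : ℕ
    k₂ = suc (suc m)

    b₀ b₁ l₀ l₁ : TreeVertex k₂
    b₀ = branch 0F
    b₁ = branch 1F
    l₀ = leaf 0F 0F
    l₁ = leaf 0F 1F

  -- Of the cards of two centre edges only bushiness is kept; the card of a leaf edge is kept in
  -- full.
  module Reattach
    (H : Graph) (f₀ f₁ f₂ : Edge H) (f₀≢f₁ : f₀ ≢ f₁)
    (bushy₀ : Bushy (Adj (H -ₑ f₀))) (bushy₁ : Bushy (Adj (H -ₑ f₁)))
    (card₂ : Adj (H -ₑ f₂) ≅ Delete _~_ b₀ l₀)
    where

    private
      φ = bij card₂

    -- `H` carried to the vertices of the tree along the third card, so that it exceeds that card by
    -- a single edge.
    Pulled : TreeVertex k₂ → TreeVertex k₂ → Set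
    Pulled x y = Adj H (φ ⟵ x) (φ ⟵ y)

    pulled≅ : Pulled ≅ Adj H
    pulled≅ = record { bij = ↔-sym φ ; fwd = id ; bwd = id }

    -- By `tail-edge`, both `f₀` and `f₁` would be the last edge of the tail.
    ¬pulledTail : ∀ {x y} → ¬ Tail Pulled x y
    ¬pulledTail t = f₀≢f₁ (joins-unique {H} (tail-edge H f₀ t′ bushy₀) (tail-edge H f₁ t′ bushy₁))
      where t′ = Tail-map pulled≅ t

    pulled-cases : ∀ {x y} → Pulled x y →
                   Delete _~_ b₀ l₀ x y ⊎ IsPair (φ ⟶ src f₂) (φ ⟶ tgt f₂) x y
    pulled-cases {x} {y} xy with joins? H f₂ (φ ⟵ x) (φ ⟵ y)
    ... | yes j = inj₂ (subst₂ (IsPair _ _) (strictlyInverseˡ φ x) (strictlyInverseˡ φ y)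
                          (IsPair-map (φ ⟶_) j))
    ... | no ¬j = inj₁ (subst₂ (Delete _~_ b₀ l₀) (strictlyInverseˡ φ x) (strictlyInverseˡ φ y)
                          (fwd card₂ (Adj⇒card H f₂ xy ¬j)))

    delete⇒pulled : ∀ {x y} → Delete _~_ b₀ l₀ x y → Pulled x y
    delete⇒pulled = card⇒Adj H f₂ ∘ bwd card₂ ∘
      subst₂ (Delete _~_ b₀ l₀) (sym (strictlyInverseˡ φ _)) (sym (strictlyInverseˡ φ _))

    -- Here `l₀` and `w` are the ends of the edge of `H` missing from the third card; the aim is
    -- `w ≡ b₀`.
    module _ {w : TreeVertex k₂}
             (cases : ∀ {x y} → Pulled x y → Delete _~_ b₀ l₀ x y ⊎ IsPair l₀ w x y)
             (l₀w : Pulled l₀ w) where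

      c-b₀ : Pulled centre b₀
      c-b₀ = delete⇒pulled (c~b , λ { (inj₁ (() , _)) ; (inj₂ (() , _)) })

      b₀-l₁ : Pulled b₀ l₁
      b₀-l₁ = delete⇒pulled (b~l , λ { (inj₁ (_ , ())) ; (inj₂ (() , _)) })

      w≡b₀⇒≃ : w ≡ b₀ → H ≃ Tree k₂
      w≡b₀⇒≃ refl = ≅⇒≃ {H} {Tree k₂} (≅-trans (≅-sym pulled≅) (≅-trans (record
        { bij = ↔-refl
        ; fwd = λ {x} {y} xy → [ proj₁ , pair⇒~ ]′ (cases xy)
        ; bwd = λ {x} {y} → ~⇒pulled x y
        }) (≅-sym tree≅~)))
        where
        pair⇒~ : ∀ {x y} → IsPair l₀ b₀ x y → x ~ y
        pair⇒~ (inj₁ (refl , refl)) = l~b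
        pair⇒~ (inj₂ (refl , refl)) = b~l
        ~⇒pulled : ∀ x y → x ~ y → Pulled x y
        ~⇒pulled x y x~y with isPair? _≟V_ b₀ l₀ x y
        ... | yes (inj₁ (refl , refl)) = Adj-sym H l₀w
        ... | yes (inj₂ (refl , refl)) = l₀w
        ... | no ¬p = delete⇒pulled (x~y , ¬p)

      -- Otherwise `l₀`, `l₁`, `b₀`, `centre` form a tail: `l₀` hangs from `l₁`, whose only further
      -- neighbour is `b₀`.
      w≢l₁ : w ≢ l₁
      w≢l₁ refl = ¬pulledTail record
        { uv     = l₀w
        ; vx     = Adj-sym H b₀-l₁
        ; xy     = Adj-sym H c-b₀
        ; u≢x    = λ ()
        ; v≢y    = λ ()
        ; only-u = only-l₀ ∘ cases
        ; only-v = only-l₁ ∘ cases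
        }
        where
        only-l₀ : ∀ {z} → Delete _~_ b₀ l₀ l₀ z ⊎ IsPair l₀ l₁ l₀ z → z ≡ l₁
        only-l₀ (inj₁ (l~b , ¬p))         = ⊥-elim (¬p (inj₂ (refl , refl)))
        only-l₀ (inj₂ (inj₁ (_ , z≡l₁))) = z≡l₁
        only-l₁ : ∀ {z} → Delete _~_ b₀ l₀ l₁ z ⊎ IsPair l₀ l₁ l₁ z → z ≡ l₀ ⊎ z ≡ b₀
        only-l₁ (inj₁ (l~b , _))          = inj₂ refl
        only-l₁ (inj₂ (inj₂ (_ , z≡l₀))) = inj₁ z≡l₀

      -- Otherwise `l₁`, `b₀`, `centre`, `b₁` form a tail: `l₁` has degree one because `w ≢ l₁`, and
      -- `b₀` has lost `l₀` and gained nothing.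
      w≡b₀ : w ≡ b₀
      w≡b₀ with w ≟V b₀
      ... | yes eq   = eq
      ... | no  w≢b₀ = ⊥-elim (¬pulledTail record
        { uv     = Adj-sym H b₀-l₁
        ; vx     = Adj-sym H c-b₀
        ; xy     = delete⇒pulled (c~b {i = 1F} , λ { (inj₁ (() , _)) ; (inj₂ (() , _)) })
        ; u≢x    = λ ()
        ; v≢y    = λ ()
        ; only-u = only-l₁ ∘ cases
        ; only-v = only-b₀ ∘ cases
        })
        where
        only-l₁ : ∀ {z} → Delete _~_ b₀ l₀ l₁ z ⊎ IsPair l₀ w l₁ z → z ≡ b₀
        only-l₁ (inj₁ (l~b , _))          = refl
        only-l₁ (inj₂ (inj₂ (l₁≡w , _))) = ⊥-elim (w≢l₁ (sym l₁≡w))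
        only-b₀ : ∀ {z} → Delete _~_ b₀ l₀ b₀ z ⊎ IsPair l₀ w b₀ z → z ≡ l₁ ⊎ z ≡ centre
        only-b₀ (inj₁ (b~c , _))           = inj₂ refl
        only-b₀ (inj₁ (b~l {t = 0F} , ¬p)) = ⊥-elim (¬p (inj₁ (refl , refl)))
        only-b₀ (inj₁ (b~l {t = 1F} , _))  = inj₁ refl
        only-b₀ (inj₂ (inj₂ (b₀≡w , _)))  = ⊥-elim (w≢b₀ (sym b₀≡w))

      reattached≃ : H ≃ Tree k₂
      reattached≃ = w≡b₀⇒≃ w≡b₀

    reconstructed : H ≃ Tree k₂
    -- `l₀` has a neighbour in the first card, hence in `H`, but is isolated in the third card. So
    -- the edge deleted there ends at `l₀`.
    reconstructed with noIsolated bushy₀ (φ ⟵ l₀)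
    ... | z , l₀z = case (pulled-cases l₀z′)
      where
      l₀z′ : Pulled l₀ (φ ⟶ z)
      l₀z′ = subst (Adj H _) (sym (strictlyInverseʳ φ z)) (card⇒Adj H f₀ l₀z)
      case : Delete _~_ b₀ l₀ l₀ (φ ⟶ z) ⊎ IsPair (φ ⟶ src f₂) (φ ⟶ tgt f₂) l₀ (φ ⟶ z) →
             H ≃ Tree k₂
      case (inj₁ (l~z , ¬p)) = ⊥-elim (l₀~ l~z ¬p)
        where
        l₀~ : ∀ {w} → l₀ ~ w → ¬ ¬ IsPair b₀ l₀ l₀ w
        l₀~ l~b ¬p = ¬p (inj₂ (refl , refl))
      case (inj₂ j) = reattached≃
        ([ inj₁ , inj₂ ∘ IsPair-trans (IsPair-sym j) ]′ ∘ pulled-cases) l₀z′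

-- Lower bound

-- Graphs on the named vertices of the tree, with Boolean adjacency so that concrete entries
-- evaluate.
record TreeGraph (k : ℕ) : Set where
  constructor treeGraph
  field
    adjV    : TreeVertex k → TreeVertex k → Bool
    symV    : ∀ x y → adjV x y ≡ adjV y x
    irreflV : ∀ x → adjV x x ≡ false

open TreeGraph

toGraph : TreeGraph k → Graph
toGraph {k} G = record
  { order  = 1 + 3 * k
  ; adj    = λ u v → adjV G (treeVertex {k} u) (treeVertex {k} v)
  ; symm   = λ u v → symV G (treeVertex {k} u) (treeVertex {k} v)
  ; irrefl = λ v → irreflV G (treeVertex {k} v)
  }

tree : ∀ k → TreeGraph k
tree k = treeGraph treeAdj treeAdj-sym treeAdj-irrefl

AdjV : TreeGraph k → TreeVertex k → TreeVertex k → Set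
AdjV G x y = T (adjV G x y)

toGraph≅ : (G : TreeGraph k) → Adj (toGraph G) ≅ AdjV G
toGraph≅ G = record { bij = vertices ; fwd = id ; bwd = id }

pairV : TreeVertex k → TreeVertex k → TreeVertex k → TreeVertex k → Bool
pairV = pairᵇ _≟V_

-- Unordered, since the numbering of the vertices decides which end is `src`.
Ends : (G : TreeGraph k) → Edge (toGraph G) → TreeVertex k → TreeVertex k → Set
Ends G e x y = IsPair x y (treeVertex (src e)) (treeVertex (tgt e))

edgeBetweenV : (G : TreeGraph k) (x y : TreeVertex k) → AdjV G x y →
               Σ[ e ∈ Edge (toGraph G) ] Ends G e x y
edgeBetweenV G x y xy with edgeBetween (toGraph G) (index x) (index y)
  (subst₂ (AdjV G) (sym (treeVertex-index x)) (sym (treeVertex-index y)) xy)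
... | e , j = e , subst₂ (λ p q → IsPair p q _ _) (treeVertex-index x) (treeVertex-index y)
                    (IsPair-map treeVertex (IsPair-sym j))

samePair-ends : (G : TreeGraph k) {e : Edge (toGraph G)} {x y : TreeVertex k} → Ends G e x y →
                ∀ u v → samePair (src e) (tgt e) u v ≡ pairV x y (treeVertex u) (treeVertex v)
samePair-ends G {e} {x} {y} j u v = pairᵇ-cong _≟F_ _≟V_
  {src e} {tgt e} {u} {v} {x} {y} {treeVertex u} {treeVertex v}
  (IsPair-trans j ∘ IsPair-map treeVertex)
  (IsPair-unmap (↔-injective vertices) ∘ IsPair-trans (IsPair-sym j))

infixl 7 _∧¬_

_∧¬_ : Bool → Bool → Bool
b ∧¬ c = b ∧ not c

-- Moves the comparison of two cards from numbered to named vertices, where it becomes a Boolean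
-- identity.
card-≃ : (G H : TreeGraph k) {e : Edge (toGraph G)} {f : Edge (toGraph H)}
         {x y z w : TreeVertex k} →
         Ends G e x y → Ends H f z w → (σ : TreeVertex k ↔ TreeVertex k) →
         (∀ p q → adjV G p q ∧¬ pairV x y p q ≡
                  adjV H (σ ⟶ p) (σ ⟶ q) ∧¬ pairV z w (σ ⟶ p) (σ ⟶ q)) →
         (toGraph G -ₑ e) ≃ (toGraph H -ₑ f)
card-≃ G H {e} {f} {x} {y} {z} {w} i j σ h = φ , λ u v → begin
  adj (toGraph G -ₑ e) u v
    ≡⟨ cong (adjV G (treeVertex u) (treeVertex v) ∧¬_) (samePair-ends G {e} i u v) ⟩
  adjV G (treeVertex u) (treeVertex v) ∧¬ pairV x y (treeVertex u) (treeVertex v)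
    ≡⟨ h (treeVertex u) (treeVertex v) ⟩
  H∖zw (σ ⟶ treeVertex u) (σ ⟶ treeVertex v)
    ≡⟨ cong₂ H∖zw (treeVertex-index _) (treeVertex-index _) ⟨
  H∖zw (treeVertex (φ ⟶ u)) (treeVertex (φ ⟶ v))
    ≡⟨ cong (adjV H (treeVertex (φ ⟶ u)) (treeVertex (φ ⟶ v)) ∧¬_)
         (samePair-ends H {f} j (φ ⟶ u) (φ ⟶ v)) ⟨
  adj (toGraph H -ₑ f) (φ ⟶ u) (φ ⟶ v)
    ∎
  where
  open ≡-Reasoning
  φ = ↔-trans vertices (↔-trans σ (↔-sym vertices))
  H∖zw = λ p q → adjV H p q ∧¬ pairV z w p q

-- Automorphisms of the tree and the cards they identify

-- Applying `ρ` to the leaves of all branches at once still gives enough automorphisms to carry any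
-- leaf edge to any other.
permuteBranches : Permutation′ k → Permutation′ 2 → TreeVertex k ↔ TreeVertex k
permuteBranches π ρ = mk↔ₛ′ (act (π ⟶_) (ρ ⟶_)) (act (π ⟵_) (ρ ⟵_))
  (act-inverse (strictlyInverseˡ π) (strictlyInverseˡ ρ))
  (act-inverse (strictlyInverseʳ π) (strictlyInverseʳ ρ))
  where
  act : (Fin _ → Fin _) → (Fin 2 → Fin 2) → TreeVertex _ → TreeVertex _
  act f g centre     = centre
  act f g (branch i) = branch (f i)
  act f g (leaf i t) = leaf (f i) (g t)
  act-inverse : ∀ {f f⁻¹ g g⁻¹} → (∀ i → f (f⁻¹ i) ≡ i) → (∀ t → g (g⁻¹ t) ≡ t) →
                ∀ x → act f g (act f⁻¹ g⁻¹ x) ≡ x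
  act-inverse p q centre     = refl
  act-inverse p q (branch i) = cong branch (p i)
  act-inverse p q (leaf i t) = cong₂ leaf (p i) (q t)

permuteBranches-~ : (π : Permutation′ k) (ρ : Permutation′ 2) → ∀ {x y} → x ~ y →
                    (permuteBranches π ρ ⟶ x) ~ (permuteBranches π ρ ⟶ y)
permuteBranches-~ π ρ c~b = c~b
permuteBranches-~ π ρ b~c = b~c
permuteBranches-~ π ρ b~l = b~l
permuteBranches-~ π ρ l~b = l~b

treeAdj-permuteBranches : (π : Permutation′ k) (ρ : Permutation′ 2) (x y : TreeVertex k) →
  treeAdj x y ≡ treeAdj (permuteBranches π ρ ⟶ x) (permuteBranches π ρ ⟶ y)
treeAdj-permuteBranches π ρ x y = T-injective
  (~⇒treeAdj ∘ permuteBranches-~ π ρ ∘ treeAdj⇒~ x y)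
  (~⇒treeAdj ∘ subst₂ _~_ (strictlyInverseʳ σ x) (strictlyInverseʳ σ y)
             ∘ permuteBranches-~ (↔-sym π) (↔-sym ρ) ∘ treeAdj⇒~ _ _)
  where σ = permuteBranches π ρ

permuteBranches-card-≃ : (π : Permutation′ k) (ρ : Permutation′ 2)
  {e f : Edge (Tree k)} {x y : TreeVertex k} →
  Ends (tree k) e x y → Ends (tree k) f (permuteBranches π ρ ⟶ x) (permuteBranches π ρ ⟶ y) →
  (Tree k -ₑ e) ≃ (Tree k -ₑ f)
permuteBranches-card-≃ {k} π ρ {e} {f} {x} {y} i j = card-≃ (tree k) (tree k) {e} {f} i j σ λ p q →
  cong₂ _∧¬_ (treeAdj-permuteBranches π ρ p q)
    (pairᵇ-cong _≟V_ _≟V_ {x} {y} {p} {q} {σ ⟶ x} {σ ⟶ y} {σ ⟶ p} {σ ⟶ q}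
      (IsPair-map (σ ⟶_)) (IsPair-unmap (↔-injective σ)))
  where σ = permuteBranches π ρ

transpose-first : (i j : Fin n) → transpose i j ⟶ i ≡ j
transpose-first i j rewrite dec-true (i ≟F i) refl = refl

-- Exchanging an edge at the first branch

-- The only vertices touched when an edge is moved, indexed by `Fin 4` so that claims about them can
-- be decided by enumeration.
near : Fin 4 → TreeVertex (suc k)
near 0F = centre
near 1F = branch 0F
near 2F = leaf 0F 0F
near 3F = leaf 0F 1F

near-injective : Injective _≡_ _≡_ (near {k})
near-injective {x = i} {j} eq = trans (sym (near⁻¹-near i)) (trans (cong near⁻¹ eq) (near⁻¹-near j))
  where
  near⁻¹ : TreeVertex _ → Fin 4
  near⁻¹ centre     = 0F
  near⁻¹ (branch _) = 1F
  near⁻¹ (leaf _ t) = suc (suc t)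
  near⁻¹-near : ∀ i → near⁻¹ (near i) ≡ i
  near⁻¹-near 0F = refl
  near⁻¹-near 1F = refl
  near⁻¹-near 2F = refl
  near⁻¹-near 3F = refl

data Far : TreeVertex (suc k) → Set where
  branch : ∀ {i : Fin k} → Far (branch (suc i))
  leaf   : ∀ {i : Fin k} {t} → Far (leaf (suc i) t)

near-or-far : (x : TreeVertex (suc k)) → (∃[ i ] near i ≡ x) ⊎ Far x
near-or-far centre           = inj₁ (0F , refl)
near-or-far (branch 0F)      = inj₁ (1F , refl)
near-or-far (branch (suc i)) = inj₂ branch
near-or-far (leaf 0F 0F)     = inj₁ (2F , refl)
near-or-far (leaf 0F 1F)     = inj₁ (3F , refl)
near-or-far (leaf (suc i) t) = inj₂ leaf

far≢near : ∀ {x : TreeVertex (suc k)} → Far x → ∀ i → x ≢ near i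
far≢near branch 0F ()
far≢near branch 1F ()
far≢near branch 2F ()
far≢near branch 3F ()
far≢near leaf   0F ()
far≢near leaf   1F ()
far≢near leaf   2F ()
far≢near leaf   3F ()

nearPair : Fin 4 × Fin 4 → TreeVertex (suc k) → TreeVertex (suc k) → Bool
nearPair (i , j) = pairV (near i) (near j)

nearPair-sym : ∀ e (x y : TreeVertex (suc k)) → nearPair e x y ≡ nearPair e y x
nearPair-sym (i , j) x y = pairᵇ-cong _≟V_ _≟V_ {near i} {near j} {x} {y} {near i} {near j} {y} {x}
  IsPair-swapʳ IsPair-swapʳ

nearPair-far : ∀ e {x y : TreeVertex (suc k)} → Far x ⊎ Far y → nearPair e x y ≡ false
nearPair-far (i , j) {x} {y} far = pairᵇ-false _≟V_ (¬pair far)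
  where
  ¬pair : Far x ⊎ Far y → ¬ IsPair (near i) (near j) x y
  ¬pair (inj₁ fx) (inj₁ (p , _)) = far≢near fx i p
  ¬pair (inj₁ fx) (inj₂ (p , _)) = far≢near fx j p
  ¬pair (inj₂ fy) (inj₁ (_ , q)) = far≢near fy j q
  ¬pair (inj₂ fy) (inj₂ (_ , q)) = far≢near fy i q

exchange : ∀ {k} (e g : Fin 4 × Fin 4) → proj₁ g ≢ proj₂ g → TreeGraph (suc k)
exchange e g g≢ = treeGraph
  (λ x y → treeAdj x y ∧¬ nearPair e x y ∨ nearPair g x y)
  (λ x y → cong₂ _∨_ (cong₂ _∧¬_ (treeAdj-sym x y) (nearPair-sym e x y)) (nearPair-sym g x y))
  (λ x → cong₂ _∨_ (cong (_∧¬ nearPair e x x) (treeAdj-irrefl x))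
           (pairᵇ-false _≟V_ {near (proj₁ g)} {near (proj₂ g)} {x} {x} λ where
             (inj₁ (p , q)) → g≢ (near-injective (trans (sym p) q))
             (inj₂ (p , q)) → g≢ (near-injective (trans (sym q) p))))

exchange-far : ∀ {e g} (g≢ : proj₁ g ≢ proj₂ g) {x y : TreeVertex (suc k)} → Far x ⊎ Far y →
               adjV (exchange e g g≢) x y ≡ treeAdj x y
exchange-far {e = e} {g} g≢ {x} {y} far
  rewrite nearPair-far e far | nearPair-far g far = trans (∨-identityʳ _) (∧-identityʳ _)

-- The index `i` stands for `near (suc i)`, so `π` acts on b₀, l₀, l₁. The result need not be an
-- automorphism of the tree.
permuteNear : Permutation′ 3 → TreeVertex (suc k) ↔ TreeVertex (suc k)
permuteNear {k} π = mk↔ₛ′ (act (π ⟶_)) (act (π ⟵_))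
  (act-inverse (strictlyInverseˡ π)) (act-inverse (strictlyInverseʳ π))
  where
  act : (Fin 3 → Fin 3) → TreeVertex (suc k) → TreeVertex (suc k)
  act f centre           = centre
  act f (branch 0F)      = near (suc (f 0F))
  act f (branch (suc i)) = branch (suc i)
  act f (leaf 0F t)      = near (suc (f (suc t)))
  act f (leaf (suc i) t) = leaf (suc i) t
  act-near : ∀ f i → act f (near (suc i)) ≡ near (suc (f i))
  act-near f 0F = refl
  act-near f 1F = refl
  act-near f 2F = refl
  act-inverse : ∀ {f g} → (∀ i → f (g i) ≡ i) → ∀ x → act f (act g x) ≡ x
  act-inverse         p centre           = refl
  act-inverse {g = g} p (branch 0F)      = trans (act-near _ (g 0F)) (cong (near ∘ suc) (p 0F))
  act-inverse         p (branch (suc i)) = refl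
  act-inverse {g = g} p (leaf 0F 0F)     = trans (act-near _ (g 1F)) (cong (near ∘ suc) (p 1F))
  act-inverse {g = g} p (leaf 0F 1F)     = trans (act-near _ (g 2F)) (cong (near ∘ suc) (p 2F))
  act-inverse         p (leaf (suc i) t) = refl

permuteNear-far : ∀ π {x : TreeVertex (suc k)} → Far x → permuteNear π ⟶ x ≡ x
permuteNear-far π branch = refl
permuteNear-far π leaf   = refl

permuteNear-preserves-far : ∀ π {x : TreeVertex (suc k)} → Far x → Far (permuteNear π ⟶ x)
permuteNear-preserves-far π branch = branch
permuteNear-preserves-far π leaf   = leaf

treeAdj-far-near : ∀ {x : TreeVertex (suc k)} → Far x → ∀ i → treeAdj x (near (suc i)) ≡ false
treeAdj-far-near branch 0F = refl
treeAdj-far-near branch 1F = refl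
treeAdj-far-near branch 2F = refl
treeAdj-far-near leaf   0F = refl
treeAdj-far-near leaf   1F = refl
treeAdj-far-near leaf   2F = refl

treeAdj-permuteNearʳ : ∀ π {x : TreeVertex (suc k)} → Far x → ∀ y →
                       treeAdj x y ≡ treeAdj x (permuteNear π ⟶ y)
treeAdj-permuteNearʳ π far centre           = refl
treeAdj-permuteNearʳ π far (branch (suc i)) = refl
treeAdj-permuteNearʳ π far (leaf (suc i) t) = refl
treeAdj-permuteNearʳ π far (branch 0F)      =
  trans (treeAdj-far-near far 0F) (sym (treeAdj-far-near far (π ⟶ 0F)))
treeAdj-permuteNearʳ π far (leaf 0F 0F)     =
  trans (treeAdj-far-near far 1F) (sym (treeAdj-far-near far (π ⟶ 1F)))
treeAdj-permuteNearʳ π far (leaf 0F 1F)     =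
  trans (treeAdj-far-near far 2F) (sym (treeAdj-far-near far (π ⟶ 2F)))

-- A far vertex is fixed and is adjacent to none of the three permuted vertices.
treeAdj-permuteNear : ∀ π {x y : TreeVertex (suc k)} → Far x ⊎ Far y →
                      treeAdj x y ≡ treeAdj (permuteNear π ⟶ x) (permuteNear π ⟶ y)
treeAdj-permuteNear π {x} {y} (inj₁ far) =
  trans (treeAdj-permuteNearʳ π far y) (cong (λ x → treeAdj x _) (sym (permuteNear-far π far)))
treeAdj-permuteNear π {x} {y} (inj₂ far) = trans (treeAdj-sym x y)
  (trans (treeAdj-permuteNear π {y} {x} (inj₁ far)) (treeAdj-sym (permuteNear π ⟶ y) _))

-- Away from the first branch nothing changes, so an isomorphism permuting its
-- three vertices need only be checked on those and the centre.
module _ {e g : Fin 4 × Fin 4} (g≢ : proj₁ g ≢ proj₂ g)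
         (f e′ : Fin 4 × Fin 4) (π : Permutation′ 3) where

  private
    G : TreeGraph (suc k)
    G = exchange e g g≢

    AgreeAt : TreeVertex (suc k) → TreeVertex (suc k) → Set
    AgreeAt x y = adjV G x y ∧¬ nearPair f x y ≡
                  treeAdj (permuteNear π ⟶ x) (permuteNear π ⟶ y) ∧¬
                  nearPair e′ (permuteNear π ⟶ x) (permuteNear π ⟶ y)

  AgreeNear : ℕ → Set
  AgreeNear k = ∀ i j → AgreeAt {k} (near i) (near j)

  -- Sixteen Boolean identities, which evaluate even while `k` is a variable.
  agreeNear? : ∀ k → Dec (AgreeNear k)
  agreeNear? k = all? λ i → all? λ j → _ Bool.≟ _

  agree-far : {x y : TreeVertex (suc k)} → Far x ⊎ Far y → AgreeAt x y
  agree-far {x = x} {y} far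
    rewrite nearPair-far f far | exchange-far {e = e} {g} g≢ far
          | nearPair-far e′ (map (permuteNear-preserves-far π) (permuteNear-preserves-far π) far) =
    cong (_∧¬ false) (treeAdj-permuteNear π far)

  agree : AgreeNear k → (x y : TreeVertex (suc k)) → AgreeAt x y
  agree h x y with near-or-far x | near-or-far y
  ... | inj₁ (i , refl) | inj₁ (j , refl) = h i j
  ... | inj₁ _          | inj₂ fy         = agree-far {x = x} (inj₂ fy)
  ... | inj₂ fx         | _               = agree-far {x = x} (inj₁ fx)

-- Graphs sharing two cards with the tree

-- Indexed by the cards rather than by edges of `G`, so that it can be carried along isomorphisms of
-- cards. Distinctness is asked of the edges of `H`; the cards `P` and `Q` may be equal.
record Counterexample (G P Q : Graph) : Set where
  field
    H   : Graph
    f g : Edge H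
    f≢g : f ≢ g
    H-f : (H -ₑ f) ≃ P
    H-g : (H -ₑ g) ≃ Q
    H≄G : ¬ H ≃ G

transport : ∀ {G P Q P′ Q′} → P′ ≃ P → Q′ ≃ Q → Counterexample G P Q → Counterexample G P′ Q′
transport {P = P} {Q} {P′} {Q′} i j c = record
  { H = H ; f = f ; g = g ; f≢g = f≢g ; H≄G = H≄G
  ; H-f = ≃-trans {H -ₑ f} {P} {P′} H-f (≃-sym {P′} {P} i)
  ; H-g = ≃-trans {H -ₑ g} {Q} {Q′} H-g (≃-sym {Q′} {Q} j)
  }
  where open Counterexample c

swapCards : ∀ {G P Q} → Counterexample G P Q → Counterexample G Q P
swapCards c = record
  { H = H ; f = g ; g = f ; f≢g = f≢g ∘ sym ; H-f = H-g ; H-g = H-f ; H≄G = H≄G }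
  where open Counterexample c

edge-c-b : ∀ k → Σ[ e ∈ Edge (Tree (suc k)) ] Ends (tree (suc k)) e centre (branch 0F)
edge-c-b k = edgeBetweenV (tree (suc k)) centre (branch 0F) _

edge-b-l : ∀ k → Σ[ e ∈ Edge (Tree (suc k)) ] Ends (tree (suc k)) e (branch 0F) (leaf 0F 0F)
edge-b-l k = edgeBetweenV (tree (suc k)) (branch 0F) (leaf 0F 0F) _

-- In the tree the edge `e` is replaced by `g`. Deleting `g` gives back the card of `e`; deleting
-- `f` is to give the card of `e′` once b₀ and l₁ trade places.
module _ {e g : Fin 4 × Fin 4} (g≢ : proj₁ g ≢ proj₂ g) (f e′ : Fin 4 × Fin 4) where

  private
    H : TreeGraph (suc k)
    H = exchange e g g≢

    NearEnds : Edge (Tree (suc k)) → Fin 4 × Fin 4 → Set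
    NearEnds t (i , j) = Ends (tree _) t (near i) (near j)

  -- transpose 0F 0F is the identity and transpose 0F 2F exchanges b₀ with l₁.
  exchange-counterexample :
    {t t′ : Edge (Tree (suc k))} → NearEnds t e → NearEnds t′ e′ →
    AdjV {suc k} H (near (proj₁ g)) (near (proj₂ g)) →
    AdjV {suc k} H (near (proj₁ f)) (near (proj₂ f)) →
    ¬ T (nearPair {k} g (near (proj₁ f)) (near (proj₂ f))) →
    AgreeNear {e} {g} g≢ g e (transpose 0F 0F) k →
    AgreeNear {e} {g} g≢ f e′ (transpose 0F 2F) k →
    ¬ (AdjV {suc k} H ≅ _~_ {suc k}) →
    Counterexample (Tree (suc k)) (Tree (suc k) -ₑ t) (Tree (suc k) -ₑ t′)
  exchange-counterexample {k} {t} {t′} te te′ gg ff g≢f ok ok′ H≇~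
    with edgeBetweenV H (near (proj₁ g)) (near (proj₂ g)) gg
       | edgeBetweenV H (near (proj₁ f)) (near (proj₂ f)) ff
  ... | eg , endsg | ef , endsf = record
    { H = toGraph H
    ; f = eg
    ; g = ef
    ; f≢g = λ { refl → g≢f (IsPair⇒pairᵇ _≟V_ (near (proj₁ f)) (near (proj₂ f))
                              (IsPair-trans endsg (IsPair-sym endsf))) }
    ; H-f = card-≃ H (tree (suc k)) {eg} {t} endsg te (permuteNear (transpose 0F 0F))
              (agree g≢ g e (transpose 0F 0F) ok)
    ; H-g = card-≃ H (tree (suc k)) {ef} {t′} endsf te′ (permuteNear (transpose 0F 2F))
              (agree g≢ f e′ (transpose 0F 2F) ok′)
    ; H≄G = λ h → H≇~ (≅-trans (≅-sym (toGraph≅ H))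
                       (≅-trans (≃⇒≅ {toGraph H} {Tree (suc k)} h) tree≅~))
    }

~-triangleFree : {x y z : TreeVertex k} → x ~ y → y ~ z → ¬ z ~ x
~-triangleFree c~b b~c ()
~-triangleFree c~b b~l ()
~-triangleFree b~c c~b ()
~-triangleFree b~l l~b ()
~-triangleFree l~b b~c ()
~-triangleFree l~b b~l ()

triangle⇒≇~ : {R : A → A → Set} {x y z : A} → R x y → R y z → R z x → ¬ (R ≅ _~_ {k})
triangle⇒≇~ xy yz zx i = ~-triangleFree (fwd i xy) (fwd i yz) (fwd i zx)

tail⇒≇~ : {R : A → A → Set} {x y : A} → Tail R x y → ¬ (R ≅ _~_ {k})
tail⇒≇~ t i = ¬Tail id b~l (Tail-map i t)

module _ {k : ℕ} where

  private
    K = suc k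
    t-c-b = proj₁ (edge-c-b k)
    t-b-l = proj₁ (edge-b-l k)

  -- The first branch becomes a triangle b₀ l₀ l₁ cut off from the centre. Deleting l₀ l₁ or b₀ l₀
  -- turns it into a path on three vertices, which is also what the tree has there without c b₀.
  counterexample-cb-cb : Counterexample (Tree K) (Tree K -ₑ t-c-b) (Tree K -ₑ t-c-b)
  counterexample-cb-cb = exchange-counterexample {0F , 1F} {2F , 3F} (λ ()) (1F , 2F) (0F , 1F)
    {t = t-c-b} {t-c-b}
    (proj₂ (edge-c-b k)) (proj₂ (edge-c-b k)) _ _ (λ ())
    (from-yes (agreeNear? {0F , 1F} {2F , 3F} (λ ()) (2F , 3F) (0F , 1F) (transpose 0F 0F) k))
    (from-yes (agreeNear? {0F , 1F} {2F , 3F} (λ ()) (1F , 2F) (0F , 1F) (transpose 0F 2F) k))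
    (triangle⇒≇~ {x = near 1F} {near 2F} {near 3F} _ _ _)

  -- Now l₀ is isolated and c b₀ l₁ is a triangle. Once c b₀ is deleted, l₁ takes the part of b₀.
  counterexample-bl-bl : Counterexample (Tree K) (Tree K -ₑ t-b-l) (Tree K -ₑ t-b-l)
  counterexample-bl-bl = exchange-counterexample {1F , 2F} {0F , 3F} (λ ()) (0F , 1F) (1F , 2F)
    {t = t-b-l} {t-b-l}
    (proj₂ (edge-b-l k)) (proj₂ (edge-b-l k)) _ _ (λ ())
    (from-yes (agreeNear? {1F , 2F} {0F , 3F} (λ ()) (0F , 3F) (1F , 2F) (transpose 0F 0F) k))
    (from-yes (agreeNear? {1F , 2F} {0F , 3F} (λ ()) (0F , 1F) (1F , 2F) (transpose 0F 2F) k))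
    (triangle⇒≇~ {x = near 0F} {near 1F} {near 3F} _ _ _)

  -- The first branch is stretched into a path c l₁ b₀ l₀, which read from l₀ is a tail. Deleting b₀
  -- l₀ isolates l₀ and leaves l₁ in the part of b₀.
  counterexample-cb-bl : Counterexample (Tree K) (Tree K -ₑ t-c-b) (Tree K -ₑ t-b-l)
  counterexample-cb-bl = exchange-counterexample {0F , 1F} {0F , 3F} (λ ()) (1F , 2F) (1F , 2F)
    {t = t-c-b} {t-b-l}
    (proj₂ (edge-c-b k)) (proj₂ (edge-b-l k)) _ _ (λ ())
    (from-yes (agreeNear? {0F , 1F} {0F , 3F} (λ ()) (0F , 3F) (0F , 1F) (transpose 0F 0F) k))
    (from-yes (agreeNear? {0F , 1F} {0F , 3F} (λ ()) (1F , 2F) (1F , 2F) (transpose 0F 2F) k))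
    (tail⇒≇~ {x = near 3F} {near 0F} record
      { u = near 2F ; v = near 1F ; uv = _ ; vx = _ ; xy = _ ; u≢x = λ () ; v≢y = λ ()
      ; only-u = λ {z} → only-l₀ z ; only-v = λ {z} → only-b z })
    where
    H = exchange {k} (0F , 1F) (0F , 3F) λ ()
    only-l₀ : ∀ z → AdjV H (leaf 0F 0F) z → z ≡ branch 0F
    only-l₀ (branch 0F) _ = refl
    only-b : ∀ z → AdjV H (branch 0F) z → z ≡ leaf 0F 0F ⊎ z ≡ leaf 0F 1F
    only-b (leaf 0F 0F) _ = inj₁ refl
    only-b (leaf 0F 1F) _ = inj₂ refl

  -- Permuting branches and leaves carries every edge to `t-c-b` or to `t-b-l`.
  edge-cards : (e : Edge (Tree K)) →
               (Tree K -ₑ e) ≃ (Tree K -ₑ t-c-b) ⊎ (Tree K -ₑ e) ≃ (Tree K -ₑ t-b-l)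
  edge-cards e = by-ends (treeAdj⇒~ _ _ (adjacent e)) (inj₁ (refl , refl))
    where
    c-b : ∀ {i} → Ends (tree K) e centre (branch i) → (Tree K -ₑ e) ≃ (Tree K -ₑ t-c-b)
    c-b {i} j = permuteBranches-card-≃ (transpose i 0F) (transpose 0F 0F) {e} {t-c-b} j
      (subst (λ h → Ends (tree K) t-c-b centre (branch h)) (sym (transpose-first i 0F))
        (proj₂ (edge-c-b k)))
    b-l : ∀ {i t} → Ends (tree K) e (branch i) (leaf i t) → (Tree K -ₑ e) ≃ (Tree K -ₑ t-b-l)
    b-l {i} {t} j = permuteBranches-card-≃ (transpose i 0F) (transpose t 0F) {e} {t-b-l} j
      (subst₂ (λ h s → Ends (tree K) t-b-l (branch h) (leaf h s))
        (sym (transpose-first i 0F)) (sym (transpose-first t 0F)) (proj₂ (edge-b-l k)))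
    by-ends : ∀ {x y} → x ~ y → Ends (tree K) e x y →
              (Tree K -ₑ e) ≃ (Tree K -ₑ t-c-b) ⊎ (Tree K -ₑ e) ≃ (Tree K -ₑ t-b-l)
    by-ends c~b j = inj₁ (c-b j)
    by-ends b~c j = inj₁ (c-b (IsPair-swap j))
    by-ends b~l j = inj₂ (b-l j)
    by-ends l~b j = inj₂ (b-l (IsPair-swap j))

-- Assembling the two bounds

distinct₂ : ∀ {a b : A} → a ≢ b → Fin 2 ↣ A
distinct₂ {a = a} {b} a≢b = mk↣ {to = f} injective
  where
  f : Fin 2 → _
  f 0F = a
  f 1F = b
  injective : Injective _≡_ _≡_ f
  injective {0F} {0F} _  = refl
  injective {1F} {1F} _  = refl
  injective {0F} {1F} eq = ⊥-elim (a≢b eq)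
  injective {1F} {0F} eq = ⊥-elim (a≢b (sym eq))

distinct₃ : ∀ {a b c : A} → a ≢ b → a ≢ c → b ≢ c → Fin 3 ↣ A
distinct₃ {a = a} {b} {c} a≢b a≢c b≢c = mk↣ {to = f} injective
  where
  f : Fin 3 → _
  f 0F = a
  f 1F = b
  f 2F = c
  injective : Injective _≡_ _≡_ f
  injective {0F} {0F} _  = refl
  injective {1F} {1F} _  = refl
  injective {2F} {2F} _  = refl
  injective {0F} {1F} eq = ⊥-elim (a≢b eq)
  injective {0F} {2F} eq = ⊥-elim (a≢c eq)
  injective {1F} {0F} eq = ⊥-elim (a≢b (sym eq))
  injective {1F} {2F} eq = ⊥-elim (b≢c eq)
  injective {2F} {0F} eq = ⊥-elim (a≢c (sym eq))
  injective {2F} {1F} eq = ⊥-elim (b≢c (sym eq))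

-- The edges may coincide, so the case of a single card is covered by pairing it with itself.
two-cards : (e e′ : Edge (Tree (suc k))) →
            Counterexample (Tree (suc k)) (Tree (suc k) -ₑ e) (Tree (suc k) -ₑ e′)
two-cards {k} e e′ with edge-cards e | edge-cards e′
... | inj₁ i | inj₁ j = transport i j counterexample-cb-cb
... | inj₁ i | inj₂ j = transport i j counterexample-cb-bl
... | inj₂ i | inj₁ j = transport i j (swapCards counterexample-cb-bl)
... | inj₂ i | inj₂ j = transport i j counterexample-bl-bl

needs-three : ∀ n → ReconstructibleFrom (Tree (suc k)) n → 3 ≤ n
-- With no cards to match, any graph not isomorphic to the tree serves.
needs-three {k} 0 (e , r) = ⊥-elim (H≄G (r H (mk↣ {to = λ ()} λ { {()} }) λ ()))
  where open Counterexample (counterexample-cb-cb {k})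
needs-three 1 (e , r) =
  ⊥-elim (H≄G (r H (mk↣ {to = λ _ → f} λ { {0F} {0F} _ → refl }) λ { 0F → H-f }))
  where open Counterexample (two-cards (Injection.to e 0F) (Injection.to e 0F))
needs-three 2 (e , r) = ⊥-elim (H≄G (r H (distinct₂ f≢g) λ { 0F → H-f ; 1F → H-g }))
  where open Counterexample (two-cards (Injection.to e 0F) (Injection.to e 1F))
needs-three (suc (suc (suc n))) _ = s≤s (s≤s (s≤s z≤n))

three-cards : ∀ m → ReconstructibleFrom (Tree (suc (suc m))) 3
three-cards m = edges , λ H f cards →
  Reattach.reconstructed H (Injection.to f 0F) (Injection.to f 1F) (Injection.to f 2F)
    (λ eq → contradiction (Injection.injective f eq) λ ())
    -- The implicit `i` is a branch still joined to the centre: the second in the first card, the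
    -- first in the second.
    (Bushy-pull (card≅ H (Injection.to f 0F) {e₀} (cards 0F) j₀) (bushyCard {i = 1F} λ ()))
    (Bushy-pull (card≅ H (Injection.to f 1F) {e₁} (cards 1F) j₁) (bushyCard {i = 0F} λ ()))
    (card≅ H (Injection.to f 2F) {e₂} (cards 2F) j₂)
  where
  K = suc (suc m)
  between = edgeBetweenV (tree K)
  e₀ = proj₁ (between centre (branch 0F) _)
  e₁ = proj₁ (between centre (branch 1F) _)
  e₂ = proj₁ (between (branch 0F) (leaf 0F 0F) _)
  j₀ = proj₂ (between centre (branch 0F) _)
  j₁ = proj₂ (between centre (branch 1F) _)
  j₂ = proj₂ (between (branch 0F) (leaf 0F 0F) _)
  different : ∀ {e e′ x y z w} → Ends (tree K) e x y → Ends (tree K) e′ z w →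
              ¬ IsPair x y z w → e ≢ e′
  different j j′ ¬p refl = ¬p (IsPair-trans j (IsPair-sym j′))
  edges : DistinctEdges 3 (Tree K)
  edges = distinct₃ (different {e₀} {e₁} j₀ j₁ λ { (inj₁ (_ , ())) ; (inj₂ (() , _)) })
                    (different {e₀} {e₂} j₀ j₂ λ { (inj₁ (() , _)) ; (inj₂ (_ , ())) })
                    (different {e₁} {e₂} j₁ j₂ λ { (inj₁ (() , _)) ; (inj₂ (() , _)) })
  card≅ : ∀ H f {e x y} → (H -ₑ f) ≃ (Tree K -ₑ e) → Ends (tree K) e x y →
          Adj (H -ₑ f) ≅ Delete _~_ x y
  card≅ H f {e} i j = ≅-trans (≃⇒≅ {H -ₑ f} {Tree K -ₑ e} i) (card≅Delete (Tree K) tree≅~ e j)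

mainTheorem5 : (k : ℕ) → 2 ≤ k → IsErn (Tree k) 3
mainTheorem5 (suc (suc m)) (s≤s (s≤s z≤n)) = three-cards m , needs-three
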